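{- For every $r\ge3$ there is a bijection between the set of partitions of the highest root $\tilde\alpha_{C_r}=2\varepsilon_1$ of type $C_r$ into positive roots of $C_r$ and the set $\mathrm{JS}(\langle2\rangle,\langle2\rangle,r)$. In particular $K_{C_r}(\tilde\alpha_{C_r})=\mathsf{js}(\langle2\rangle,\langle2\rangle,r)$.
   Context: The positive roots of type $C_r$ are $\Phi^+_{C_r}=\{\varepsilon_i-\varepsilon_j,\ \varepsilon_i+\varepsilon_j:1\le i<j\le r\}\cup\{2\varepsilon_i:1\le i\le r\}\subset\mathbb{R}^r$; a partition of $\mu$ is a finite multiset of positive roots summing to $\mu$, and $K_{C_r}(\mu)$ is their number. A juggling state is a finitely supported integer vector $\langle s_1,s_2,\dots\rangle$ indexed by heights (trailing zeros omitted). A juggling sequence of length $n$ from $\mathbf{a}$ to $\mathbf{b}$ is a sequence $(\mathbf{s}_0,\dots,\mathbf{s}_n)$ with $\mathbf{s}_0=\mathbf{a}$, $\mathbf{s}_n=\mathbf{b}$ such that for each $i$ there are nonnegative integers $c^{(i)}_k$ (finitely many nonzero) with $\sum_k c^{(i)}_k=(\mathbf{s}_{i-1})_1$ and $(\mathbf{s}_i)_k=(\mathbf{s}_{i-1})_{k+1}+c^{(i)}_k$ for all $k\ge1$. $\mathrm{JS}(\mathbf{a},\mathbf{b},n)$ is the set of these and $\mathsf{js}$ its cardinality. -}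

module Defs where

open import Data.Fin as Fin using (Fin; inject₁; fromℕ; fromℕ<)
open import Data.Integer using (ℤ; +_; 0ℤ; 1ℤ; _+_; -_)
open import Data.List using (List; []; _∷_; foldr; applyUpTo; length)
open import Data.List.Relation.Unary.All using (All)
open import Data.List.Relation.Binary.Permutation.Propositional using (↭-setoid)
open import Data.Nat as ℕ using (ℕ; zero; suc; s≤s)
open import Data.Nat.ListAction using (sum)
open import Data.Product using (∃; ∃₂; _×_; _,_)
open import Data.Vec as Vec using (Vec; replicate; zipWith; _[_]≔_)
open import Function.Bundles using (Bijection)
open import Level using (0ℓ)
open import Relation.Binary.Bundles using (Setoid)
import Relation.Binary.Construct.On as On
open import Relation.Binary.PropositionalEquality
  using (_≡_; refl; sym; trans; setoid)

HasCardinality : Setoid 0ℓ 0ℓ → ℕ → Set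
HasCardinality S n = Bijection S (setoid (Fin n))

------------------------------------------------------------------------
-- Positive roots of type C and partitions into positive roots

-- All vectors that occur have integer coordinates, so ℤʳ replaces ℝʳ.
-- The coordinates 1, …, r are indexed by Fin r, so ε₁ is ε of the index 0.

infixl 6 _+ᵛ_ _-ᵛ_

0ᵛ : ∀ {r} → Vec ℤ r
0ᵛ = replicate _ 0ℤ

_+ᵛ_ : ∀ {r} → Vec ℤ r → Vec ℤ r → Vec ℤ r
_+ᵛ_ = zipWith _+_

_-ᵛ_ : ∀ {r} → Vec ℤ r → Vec ℤ r → Vec ℤ r
u -ᵛ v = u +ᵛ Vec.map -_ v

sumᵛ : ∀ {r} → List (Vec ℤ r) → Vec ℤ r
sumᵛ = foldr _+ᵛ_ 0ᵛ

ε : ∀ {r} → Fin r → Vec ℤ r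
ε i = 0ᵛ [ i ]≔ 1ℤ

data PositiveRoot {r : ℕ} : Vec ℤ r → Set where
  ε-ε : ∀ {i j} → i Fin.< j → PositiveRoot (ε i -ᵛ ε j)
  ε+ε : ∀ {i j} → i Fin.< j → PositiveRoot (ε i +ᵛ ε j)
  2ε  : ∀ i → PositiveRoot (ε i +ᵛ ε i)

highestRoot : ∀ {r} → 0 ℕ.< r → Vec ℤ r
highestRoot 0<r = ε (fromℕ< 0<r) +ᵛ ε (fromℕ< 0<r)

record Partition {r : ℕ} (μ : Vec ℤ r) : Set where
  field
    parts    : List (Vec ℤ r)
    positive : All PositiveRoot parts
    sums-to  : sumᵛ parts ≡ μ

-- Finite multisets are lists up to permutation; the proof fields do not
-- take part in the equality.
Partitions : ∀ {r} → Vec ℤ r → Setoid 0ℓ 0ℓ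
Partitions {r} μ = On.setoid (↭-setoid {A = Vec ℤ r}) (Partition.parts {μ = μ})

------------------------------------------------------------------------
-- Juggling states and juggling sequences

-- The argument k : ℕ of a state (and of the throw counts c below) stands
-- for the height k + 1, heights being numbered from 1.
record State : Set where
  field
    at             : ℕ → ℤ
    finite-support : ∃ λ N → ∀ k → N ℕ.≤ k → at k ≡ 0ℤ

open State public

infix 4 _≈ˢ_

_≈ˢ_ : State → State → Set
s ≈ˢ t = ∀ k → at s k ≡ at t k

entry : List ℤ → ℕ → ℤ
entry []       _       = 0ℤ
entry (x ∷ _)  zero    = x
entry (_ ∷ xs) (suc k) = entry xs k

entry-vanishes : ∀ xs k → length xs ℕ.≤ k → entry xs k ≡ 0ℤ
entry-vanishes []       _       _       = refl
entry-vanishes (_ ∷ xs) (suc k) (s≤s p) = entry-vanishes xs k p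

⟨_⟩ : List ℤ → State
⟨ xs ⟩ = record
  { at             = entry xs
  ; finite-support = length xs , entry-vanishes xs
  }

-- Since c vanishes from N on, the sum over k < N is the sum of all c k.
Step : State → State → Set
Step s t = ∃₂ λ (c : ℕ → ℕ) (N : ℕ) →
    (∀ k → N ℕ.≤ k → c k ≡ 0)
  × + sum (applyUpTo c N) ≡ at s 0
  × (∀ k → at t k ≡ at s (suc k) + + c k)

record JugglingSequence (a b : State) (n : ℕ) : Set where
  field
    states : Fin (suc n) → State
    start  : states Fin.zero ≈ˢ a
    end    : states (fromℕ n) ≈ˢ b
    step   : ∀ (i : Fin n) → Step (states (inject₁ i)) (states (Fin.suc i))

-- Two juggling sequences are equal when their states are; the throw counts
-- and bounds witnessing the steps and the finite supports are not compared.
JS : State → State → ℕ → Setoid 0ℓ 0ℓ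
JS a b n = record
  { Carrier       = JugglingSequence a b n
  ; _≈_           = λ x y → ∀ i → states x i ≈ˢ states y i
  ; isEquivalence = record
    { refl  = λ _ _ → refl
    ; sym   = λ p i k → sym (p i k)
    ; trans = λ p q i k → trans (p i k) (q i k)
    }
  }
  where open JugglingSequence

{-# OPTIONS --safe #-}

-- Exactly one part of a partition of 2ε₁ has the form ε_i + ε_j, with i ≤ j,
-- since the parts ε_i − ε_j have coordinate sum 0 and the others 2.  Replacing
-- it by ε_i − ε_{r+1} and ε_j − ε_{r+1} gives a flow of value 2 from 1 to r + 1
-- in the complete graph with edges i → j for i < j.  A juggling sequence is the
-- same flow: a ball thrown at time i that lands at time j is the edge i → j.

module Submission where

open import Defs
open import Algebra.Properties.CommutativeSemigroup using (interchange)
open import Data.Empty using (⊥)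
open import Data.Fin as Fin using (Fin; zero; suc; inject₁; fromℕ; toℕ)
open import Data.Fin.Properties using (0↔⊥; 1↔⊤; +↔⊎)
open import Data.Integer as ℤ using (ℤ; +_; 0ℤ; 1ℤ; -_)
import Data.Integer.Properties as ℤₚ
open import Data.Integer.Tactic.RingSolver using (solve-∀)
open import Data.List as List using (List; []; _∷_; _++_; applyUpTo)
import Data.List.Properties as List
open import Data.List.Relation.Binary.Permutation.Propositional hiding (refl; trans)
open import Data.List.Relation.Binary.Permutation.Propositional.Properties
  using (map⁺; ↭-map-inv; shift; ++⁺ˡ; ++⁺ʳ)
open import Data.List.Relation.Unary.All as All using (All; []; _∷_)
import Data.List.Relation.Unary.All.Properties as All
open import Data.Nat using (ℕ; zero; suc; _+_; _*_; _≤_; _<_; z≤n; s≤s; z<s)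
open import Data.Nat.ListAction using (sum)
open import Data.Nat.Properties
open import Data.Product using (Σ; ∃; ∃₂; _×_; _,_; proj₁; proj₂)
open import Data.Product.Function.Dependent.Propositional using (Σ-↔)
open import Data.Sum using (_⊎_; inj₁; inj₂)
open import Data.Sum.Algebra using (⊎-cong)
open import Data.Unit using (⊤; tt)
open import Data.Vec as Vec using (Vec; []; _∷_; zipWith; tabulate; replicate)
import Data.Vec.Properties as Vec
open import Data.Vec.Properties using (∷-injective; ∷-injectiveˡ; ∷-injectiveʳ)
open import Function.Base using (_∘_)
open import Function.Bundles using (Bijection; Inverse; _↔_; mk↔ₛ′)
import Function.Properties.Bijection as Bijection
import Function.Properties.Inverse as Inverse
open import Function.Properties.Inverse using (↔-refl; ↔-sym; ↔-trans; ↔⇒⤖)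
open import Relation.Binary.PropositionalEquality
open import Relation.Nullary using (contradiction)

-- Flows are taken with an arbitrary inflow vector `v` because the inductions delete the first
-- vertex: its row `c` then joins the inflow of the remaining vertices, and this same addition is
-- what a throw does to a juggling state. The unordered pair {i, j} survives its replacement by two
-- edges into the sink, since a vector of natural numbers with sum 2 is exactly such a pair,
-- repetition allowed. A partition is known only up to permutation, so its flow is read off by
-- counting edges, which ignores order; the sink edges need no counting, as conservation determines
-- them from the others. On the juggling side the throw counts are functions on all heights, and
-- they fit into a triangle only once no throw is known to reach beyond the final time. Finiteness
-- is proved once, for flows, and both cardinalities are that number.

infixl 6 _⊕_

_⊕_ : ∀ {n} → Vec ℕ n → Vec ℕ n → Vec ℕ n
_⊕_ = zipWith _+_

-- Flows

infixr 5 _◁_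

data Triangle : ℕ → Set where
  []  : Triangle zero
  _◁_ : ∀ {n} → Vec ℕ n → Triangle n → Triangle (suc n)

-- The entries of the triangle are the multiplicities of the edges i → j with
-- i < j ≤ n, those of the last vector of the edges i → n + 1; the vertex i
-- receives v_i units from outside.
IsFlow : ∀ {n} → Vec ℕ n → Triangle n → Vec ℕ n → Set
IsFlow []      []      []       = ⊤
IsFlow (a ∷ v) (c ◁ T) (d ∷ ds) = Vec.sum (d ∷ c) ≡ a × IsFlow (v ⊕ c) T ds

Flow : ∀ {n} → Vec ℕ n → Set
Flow {n} v = Σ (Triangle n) λ T → Σ (Vec ℕ n) λ ds → IsFlow v T ds

IsFlow-irrelevant : ∀ {n} (v : Vec ℕ n) T ds (p q : IsFlow v T ds) → p ≡ q
IsFlow-irrelevant []      []      []       _       _         = refl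
IsFlow-irrelevant (a ∷ v) (c ◁ T) (d ∷ ds) (p , f) (p′ , f′) =
  cong₂ _,_ (≡-irrelevant p p′) (IsFlow-irrelevant (v ⊕ c) T ds f f′)

Flow-≡ : ∀ {n} {v : Vec ℕ n} {T T′ ds ds′} {f : IsFlow v T ds} {f′ : IsFlow v T′ ds′} →
         T ≡ T′ → ds ≡ ds′ → _≡_ {A = Flow v} (T , ds , f) (T′ , ds′ , f′)
Flow-≡ {v = v} {T} {ds = ds} {f = f} {f′} refl refl =
  cong (λ f → T , ds , f) (IsFlow-irrelevant v T ds f f′)

-- At each vertex the sink edges carry what the inflow leaves over after the row of `T`. Hence a
-- flow is already determined by its triangle.
IsFlow-functional : ∀ {n} (v : Vec ℕ n) T ds ds′ → IsFlow v T ds → IsFlow v T ds′ → ds ≡ ds′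
IsFlow-functional []      []      []       []         _       _         = refl
IsFlow-functional (a ∷ v) (c ◁ T) (d ∷ ds) (d′ ∷ ds′) (p , f) (p′ , f′) =
  cong₂ _∷_ (+-cancelʳ-≡ (Vec.sum c) d d′ (trans p (sym p′)))
            (IsFlow-functional (v ⊕ c) T ds ds′ f f′)

-- Finiteness

Finite : Set → Set
Finite A = ∃ λ n → A ↔ Fin n

finite-↔ : ∀ {A B} → A ↔ B → Finite B → Finite A
finite-↔ A↔B (n , B↔n) = n , ↔-trans A↔B B↔n

finite-⊎ : ∀ {A B} → Finite A → Finite B → Finite (A ⊎ B)
finite-⊎ (m , A↔m) (n , B↔n) = m + n , ↔-trans (⊎-cong A↔m B↔n) (↔-sym +↔⊎)

finite-⊥ : Finite ⊥
finite-⊥ = 0 , ↔-sym 0↔⊥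

finite-⊤ : Finite ⊤
finite-⊤ = 1 , ↔-sym 1↔⊤

finite-ΣFin : ∀ n {B : Fin n → Set} → (∀ i → Finite (B i)) → Finite (Σ (Fin n) B)
finite-ΣFin zero    fin = finite-↔ (mk↔ₛ′ (λ ()) (λ ()) (λ ()) (λ ())) finite-⊥
finite-ΣFin (suc n) fin = finite-↔
  (mk↔ₛ′ (λ { (zero , b) → inj₁ b ; (suc i , b) → inj₂ (i , b) })
         (λ { (inj₁ b) → zero , b ; (inj₂ (i , b)) → suc i , b })
         (λ { (inj₁ _) → refl ; (inj₂ _) → refl })
         (λ { (zero , _) → refl ; (suc _ , _) → refl }))
  (finite-⊎ (fin zero) (finite-ΣFin n (fin ∘ suc)))

finite-Σ : ∀ {A : Set} {B : A → Set} → Finite A → (∀ a → Finite (B a)) → Finite (Σ A B)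
finite-Σ (n , A↔n) fin =
  finite-↔ (↔-sym (Σ-↔ (↔-sym A↔n) ↔-refl)) (finite-ΣFin n (fin ∘ Inverse.from A↔n))

Composition : ℕ → ℕ → Set
Composition n a = Σ (Vec ℕ n) λ c → Vec.sum c ≡ a

-- Pascal's recursion for weak compositions: a first entry 0 is deleted, a positive one is lowered
-- by 1.
finite-composition : ∀ n a → Finite (Composition n a)
finite-composition zero zero = finite-↔
  (mk↔ₛ′ (λ _ → tt) (λ _ → [] , refl) (λ _ → refl) (λ { ([] , refl) → refl })) finite-⊤
finite-composition zero (suc a) = finite-↔
  (mk↔ₛ′ (λ { ([] , ()) }) (λ ()) (λ ()) (λ { ([] , ()) })) finite-⊥
finite-composition (suc n) zero = finite-↔ {Composition (suc n) zero} {Composition n zero}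
  (mk↔ₛ′ (λ { (zero ∷ c , p) → c , p ; (suc _ ∷ _ , ()) }) (λ { (c , p) → zero ∷ c , p })
         (λ _ → refl) (λ { (zero ∷ _ , _) → refl ; (suc _ ∷ _ , ()) }))
  (finite-composition n zero)
finite-composition (suc n) (suc a) =
  finite-↔ {Composition (suc n) (suc a)} {Composition n (suc a) ⊎ Composition (suc n) a}
  (mk↔ₛ′ (λ { (zero ∷ c , p) → inj₁ (c , p) ; (suc x ∷ c , p) → inj₂ (x ∷ c , suc-injective p) })
         (λ { (inj₁ (c , p)) → zero ∷ c , p ; (inj₂ (x ∷ c , p)) → suc x ∷ c , cong suc p })
         (λ { (inj₁ _) → refl ; (inj₂ (x ∷ c , refl)) → refl })
         (λ { (zero ∷ _ , _) → refl ; (suc x ∷ c , refl) → refl }))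
  (finite-⊎ (finite-composition n (suc a)) (finite-composition (suc n) a))

-- The edges leaving the first vertex form a weak composition of its inflow; once they are chosen, a
-- flow on one vertex fewer remains.
finite-flow : ∀ {n} (v : Vec ℕ n) → Finite (Flow v)
finite-flow [] = finite-↔
  (mk↔ₛ′ (λ _ → tt) (λ _ → [] , [] , tt) (λ _ → refl) (λ { ([] , [] , _) → refl })) finite-⊤
finite-flow (a ∷ v) =
  finite-↔ {Flow (a ∷ v)} {Σ (Composition _ a) λ { (d ∷ c , _) → Flow (v ⊕ c) }}
  (mk↔ₛ′ (λ { (c ◁ T , d ∷ ds , p , f) → (d ∷ c , p) , T , ds , f })
         (λ { ((d ∷ c , p) , T , ds , f) → c ◁ T , d ∷ ds , p , f })
         (λ { ((_ ∷ _ , _) , _) → refl })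
         (λ { (_ ◁ _ , _ ∷ _ , _) → refl }))
  (finite-Σ (finite-composition _ a) λ { (d ∷ c , _) → finite-flow (v ⊕ c) })

-- Juggling sequences

-- The heights 1, …, n + 1 hold the entries of v, and then z.
profile : ∀ {n} → Vec ℕ n → ℕ → ℕ → ℕ
profile []      z zero    = z
profile []      z (suc k) = 0
profile (a ∷ v) z zero    = a
profile (a ∷ v) z (suc k) = profile v z k

profile-vanishes : ∀ {n} (v : Vec ℕ n) z k → n < k → profile v z k ≡ 0
profile-vanishes []      z (suc k) _       = refl
profile-vanishes (a ∷ v) z (suc k) (s≤s p) = profile-vanishes v z k p

profile-zeros : ∀ n k → profile (replicate n 0) 0 k ≡ 0
profile-zeros zero    zero    = refl
profile-zeros zero    (suc k) = refl
profile-zeros (suc n) zero    = refl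
profile-zeros (suc n) (suc k) = profile-zeros n k

profile-⊕ : ∀ {n} (v c : Vec ℕ n) z d k →
            profile (v ⊕ c) (z + d) k ≡ profile v z k + profile c d k
profile-⊕ []      []      z d zero    = refl
profile-⊕ []      []      z d (suc k) = refl
profile-⊕ (a ∷ v) (b ∷ c) z d zero    = refl
profile-⊕ (a ∷ v) (b ∷ c) z d (suc k) = profile-⊕ v c z d k

profile-injective : ∀ {n} (v v′ : Vec ℕ n) z z′ →
                    (∀ k → profile v z k ≡ profile v′ z′ k) → v ≡ v′ × z ≡ z′
profile-injective []      []        z z′ eq = refl , eq zero
profile-injective (a ∷ v) (a′ ∷ v′) z z′ eq
  with refl , z≡z′ ← profile-injective v v′ z z′ (eq ∘ suc) = cong (_∷ v) (eq zero) , z≡z′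

-- Turns throw counts supported on the first n + 1 heights into a row of a triangle together with a
-- sink entry.
profile-tabulate : ∀ n (c : ℕ → ℕ) → (∀ k → n < k → c k ≡ 0) →
                   ∀ k → profile (tabulate {n = n} (c ∘ toℕ)) (c n) k ≡ c k
profile-tabulate zero    c van zero    = refl
profile-tabulate zero    c van (suc k) = sym (van (suc k) z<s)
profile-tabulate (suc n) c van zero    = refl
profile-tabulate (suc n) c van (suc k) =
  profile-tabulate n (c ∘ suc) (λ k n<k → van (suc k) (s≤s n<k)) k

sum-profile : ∀ {n} (c : Vec ℕ n) d →
              sum (applyUpTo (profile c d) (suc n)) ≡ Vec.sum (d ∷ c)
sum-profile []      d = refl
sum-profile {suc n} (x ∷ c) d = begin
  x + sum (applyUpTo (profile c d) (suc n)) ≡⟨ cong (_+_ x) (sum-profile c d) ⟩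
  x + (d + Vec.sum c)                       ≡⟨ +-assoc x d _ ⟨
  x + d + Vec.sum c                         ≡⟨ cong (_+ Vec.sum c) (+-comm x d) ⟩
  d + x + Vec.sum c                         ≡⟨ +-assoc d x _ ⟩
  d + (x + Vec.sum c)                       ∎
  where open ≡-Reasoning

sum-applyUpTo-0 : ∀ (f : ℕ → ℕ) n → (∀ k → f k ≡ 0) → sum (applyUpTo f n) ≡ 0
sum-applyUpTo-0 f zero    f≡0 = refl
sum-applyUpTo-0 f (suc n) f≡0 = cong₂ _+_ (f≡0 0) (sum-applyUpTo-0 (f ∘ suc) n (f≡0 ∘ suc))

-- The bound `N` inside a `Step` is arbitrary; the number of balls thrown does not depend on it.
sum-applyUpTo-support : ∀ (f g : ℕ → ℕ) m n → (∀ k → f k ≡ g k) →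
                        (∀ k → m ≤ k → f k ≡ 0) → (∀ k → n ≤ k → g k ≡ 0) →
                        sum (applyUpTo f m) ≡ sum (applyUpTo g n)
sum-applyUpTo-support f g zero n f≗g f≡0 _ =
  sym (sum-applyUpTo-0 g n (λ k → trans (sym (f≗g k)) (f≡0 k z≤n)))
sum-applyUpTo-support f g m zero f≗g _ g≡0 =
  sum-applyUpTo-0 f m (λ k → trans (f≗g k) (g≡0 k z≤n))
sum-applyUpTo-support f g (suc m) (suc n) f≗g f≡0 g≡0 =
  cong₂ _+_ (f≗g 0) (sum-applyUpTo-support (f ∘ suc) (g ∘ suc) m n (f≗g ∘ suc)
    (λ k → f≡0 (suc k) ∘ s≤s) (λ k → g≡0 (suc k) ∘ s≤s))

state : ∀ {n} → Vec ℕ n → ℕ → State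
state {n} v z = record
  { at             = λ k → + profile v z k
  ; finite-support = suc n , λ k n<k → cong +_ (profile-vanishes v z k n<k)
  }

-- Each state records, for every vertex not yet passed, the units already under way to it; `z`
-- collects those bound for the sink. Dropping `a` from the front is the descent of all balls by one
-- height.
flowStates : ∀ {n} → Vec ℕ n → ℕ → Triangle n → Vec ℕ n → Fin (suc n) → State
flowStates v       z T       ds       zero    = state v z
flowStates (a ∷ v) z (c ◁ T) (d ∷ ds) (suc i) = flowStates (v ⊕ c) (z + d) T ds i

flowStates-end : ∀ {n} (v : Vec ℕ n) z T ds →
                 flowStates v z T ds (fromℕ n) ≈ˢ state [] (z + Vec.sum ds)
flowStates-end []      z []      []       k rewrite +-identityʳ z = refl
flowStates-end (a ∷ v) z (c ◁ T) (d ∷ ds) k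
  rewrite sym (+-assoc z d (Vec.sum ds)) = flowStates-end (v ⊕ c) (z + d) T ds k

flowStates-step : ∀ {n} (v : Vec ℕ n) z T ds → IsFlow v T ds → ∀ i →
                  Step (flowStates v z T ds (inject₁ i)) (flowStates v z T ds (suc i))
flowStates-step (a ∷ v) z (c ◁ T) (d ∷ ds) (p , f) zero =
  profile c d , suc _ , profile-vanishes c d , cong +_ (trans (sum-profile c d) p) ,
  (λ k → cong +_ (profile-⊕ v c z d k))
flowStates-step (a ∷ v) z (c ◁ T) (d ∷ ds) (p , f) (suc i) =
  flowStates-step (v ⊕ c) (z + d) T ds f i

throws-injective : ∀ {n} (v c c′ : Vec ℕ n) z d d′ →
                   state (v ⊕ c) (z + d) ≈ˢ state (v ⊕ c′) (z + d′) → c ≡ c′ × d ≡ d′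
throws-injective v c c′ z d d′ eq =
  profile-injective c c′ d d′ λ k → +-cancelˡ-≡ (profile v z k) _ _ (begin
    profile v z k + profile c d k    ≡⟨ profile-⊕ v c z d k ⟨
    profile (v ⊕ c) (z + d) k        ≡⟨ ℤₚ.+-injective (eq k) ⟩
    profile (v ⊕ c′) (z + d′) k      ≡⟨ profile-⊕ v c′ z d′ k ⟩
    profile v z k + profile c′ d′ k  ∎)
  where open ≡-Reasoning

-- The balls already in the air cancel from the second states, so these determine the first throws;
-- after that both runs continue from a common state.
flowStates-injective : ∀ {n} (v : Vec ℕ n) z T T′ ds ds′ →
                       (∀ i → flowStates v z T ds i ≈ˢ flowStates v z T′ ds′ i) →
                       T ≡ T′ × ds ≡ ds′
flowStates-injective []      z []      []        []       []         _  = refl , refl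
flowStates-injective (a ∷ v) z (c ◁ T) (c′ ◁ T′) (d ∷ ds) (d′ ∷ ds′) eq
  with refl , refl ← throws-injective v c c′ z d d′ (eq (suc zero))
  with refl , refl ← flowStates-injective (v ⊕ c) (z + d) T T′ ds ds′ (eq ∘ suc)
  = refl , refl

-- No ball may land after the last step.
height-bound : ∀ n (S : Fin (suc n) → State) (x : ℕ → ℕ) z →
               (∀ k → at (S zero) k ≡ + x k) → S (fromℕ n) ≈ˢ state [] z →
               (∀ i → Step (S (inject₁ i)) (S (suc i))) →
               ∀ k → n < k → x k ≡ 0
height-bound zero    S x z start end step (suc k) _ =
  ℤₚ.+-injective (trans (sym (start (suc k))) (end (suc k)))
height-bound (suc n) S x z start end step (suc k) (s≤s n<k)
  with c , _ , _ , _ , next ← step zero =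
  -- A ball too high only sinks by one height per step, and throws only add balls. The next state
  -- vanishes here by induction, so both summands do; natural-number counts exclude cancellation.
  m+n≡0⇒m≡0 (x (suc k)) (height-bound n (S ∘ suc) (λ k → x (suc k) + c k) z
    (λ k → trans (next k) (cong (ℤ._+ + c k) (start (suc k)))) end (step ∘ suc) k n<k)

-- The throw counts of the first step are cut off after height n + 1 and become the first row and
-- its sink entry. The remaining steps start from the inflow enlarged by that row.
steps⇒flow : ∀ {n} (v : Vec ℕ n) z z′ (S : Fin (suc n) → State) →
             S zero ≈ˢ state v z → S (fromℕ n) ≈ˢ state [] z′ →
             (∀ i → Step (S (inject₁ i)) (S (suc i))) →
             ∃₂ λ T ds → IsFlow v T ds × (∀ i → flowStates v z T ds i ≈ˢ S i)
steps⇒flow []      z z′ S start end step =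
  [] , [] , tt , λ { zero k → sym (start k) }
steps⇒flow {suc n} (a ∷ v) z z′ S start end step
  with c , N , c-vanishes , c-sum , next ← step zero =
  let open ≡-Reasoning
      next′ : ∀ k → at (S (suc zero)) k ≡ + (profile v z k + c k)
      next′ k = trans (next k) (cong (ℤ._+ + c k) (start (suc k)))
      -- The height bound is applied to the second state, where the thrown balls are already
      -- included.
      c-bound : ∀ k → n < k → c k ≡ 0
      c-bound k n<k = m+n≡0⇒n≡0 (profile v z k)
        (height-bound n (S ∘ suc) _ z′ next′ end (step ∘ suc) k n<k)
      cs = tabulate {n = n} (c ∘ toℕ)
      d = c n
      cs≗c = profile-tabulate n c c-bound
      conserved : Vec.sum (d ∷ cs) ≡ a
      conserved = begin
        Vec.sum (d ∷ cs)                      ≡⟨ sum-profile cs d ⟨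
        sum (applyUpTo (profile cs d) (suc n)) ≡⟨ sum-applyUpTo-support _ c (suc n) N cs≗c
                                                   (profile-vanishes cs d) c-vanishes ⟩
        sum (applyUpTo c N)                   ≡⟨ ℤₚ.+-injective (trans c-sum (start zero)) ⟩
        a                                     ∎
      start′ : S (suc zero) ≈ˢ state (v ⊕ cs) (z + d)
      start′ k = begin
        at (S (suc zero)) k                 ≡⟨ next′ k ⟩
        + (profile v z k + c k)             ≡⟨ cong (λ y → + (profile v z k + y)) (cs≗c k) ⟨
        + (profile v z k + profile cs d k)  ≡⟨ cong +_ (profile-⊕ v cs z d k) ⟨
        + profile (v ⊕ cs) (z + d) k        ∎
      T , ds , f , S≈ = steps⇒flow (v ⊕ cs) (z + d) z′ (S ∘ suc) start′ end (step ∘ suc)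
  in cs ◁ T , d ∷ ds , (conserved , f) ,
     λ { zero k → sym (start k) ; (suc i) → S≈ i }

-- The hypothesis `total`, that all units reach the sink, is supplied later by comparing coordinate
-- sums. It makes the last state the prescribed one.
flow⤖juggling : ∀ {n} (v : Vec ℕ n) z z′ a b → state v z ≈ˢ a → state [] z′ ≈ˢ b →
                (∀ T ds → IsFlow v T ds → z + Vec.sum ds ≡ z′) →
                Bijection (setoid (Flow v)) (JS a b n)
flow⤖juggling v z z′ a b ≈a ≈b total = record
  { to        = λ { (T , ds , f) → record
    { states = flowStates v z T ds
    ; start  = ≈a
    ; end    = λ k → trans (flowStates-end v z T ds k)
                       (trans (cong (λ y → + profile [] y k) (total T ds f)) (≈b k))
    ; step   = flowStates-step v z T ds f
    } }
  ; cong      = λ { refl i k → refl }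
  ; bijective =
      (λ {x} {y} eq →
        let T≡ , ds≡ = flowStates-injective v z (proj₁ x) (proj₁ y) (proj₁ (proj₂ x))
                         (proj₁ (proj₂ y)) eq
        in Flow-≡ T≡ ds≡)
    , λ s →
        let open JugglingSequence s
            T , ds , f , S≈ = steps⇒flow v z z′ states (λ k → trans (start k) (sym (≈a k)))
                                (λ k → trans (end k) (sym (≈b k))) step
        in (T , ds , f) , λ { refl → S≈ }
  }

-- Roots

-- Pairs i < j labelling the roots ε_i - ε_j, built in the shape of `Triangle`: `here` leaves the
-- first vertex, `there` avoids it.
data Edge : ℕ → Set where
  here  : ∀ {n} → Fin n → Edge (suc n)
  there : ∀ {n} → Edge n → Edge (suc n)

-- Unordered pairs {i, j}, possibly with i = j, for the roots ε_i + ε_j.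
data Pair : ℕ → Set where
  loop  : ∀ {n} → Pair (suc n)
  link  : ∀ {n} → Fin n → Pair (suc n)
  there : ∀ {n} → Pair n → Pair (suc n)

Root : ℕ → Set
Root n = Edge n ⊎ Pair n

castᵛ : ∀ {n} → Vec ℕ n → Vec ℤ n
castᵛ = Vec.map (+_)

unit : ∀ {n} → Fin n → Vec ℕ n
unit i = replicate _ 0 Vec.[ i ]≔ 1

edge : ∀ {n} → Edge n → Vec ℤ n
edge (here j)  = 1ℤ ∷ Vec.map -_ (ε j)
edge (there e) = 0ℤ ∷ edge e

-- The root ε_i + ε_j in natural coordinates, and equally the multiplicities of the two sink edges
-- replacing it.
endpoints : ∀ {n} → Pair n → Vec ℕ n
endpoints loop      = 2 ∷ replicate _ 0
endpoints (link j)  = 1 ∷ unit j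
endpoints (there p) = 0 ∷ endpoints p

vec : ∀ {n} → Root n → Vec ℤ n
vec (inj₁ e) = edge e
vec (inj₂ p) = castᵛ (endpoints p)

cast-zeros : ∀ n → castᵛ (replicate n 0) ≡ 0ᵛ
cast-zeros = Vec.map-replicate (+_) 0

cast-unit : ∀ {n} (i : Fin n) → castᵛ (unit i) ≡ ε i
cast-unit {n} i = trans (Vec.map-[]≔ (+_) (replicate n 0) i) (cong (Vec._[ i ]≔ 1ℤ) (cast-zeros n))

+ᵛ-identityˡ : ∀ {n} (u : Vec ℤ n) → 0ᵛ +ᵛ u ≡ u
+ᵛ-identityˡ = Vec.zipWith-identityˡ ℤₚ.+-identityˡ

+ᵛ-identityʳ : ∀ {n} (u : Vec ℤ n) → u +ᵛ 0ᵛ ≡ u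
+ᵛ-identityʳ = Vec.zipWith-identityʳ ℤₚ.+-identityʳ

+ᵛ-assoc : ∀ {n} (u v w : Vec ℤ n) → (u +ᵛ v) +ᵛ w ≡ u +ᵛ (v +ᵛ w)
+ᵛ-assoc = Vec.zipWith-assoc ℤₚ.+-assoc

+ᵛ-comm : ∀ {n} (u v : Vec ℤ n) → u +ᵛ v ≡ v +ᵛ u
+ᵛ-comm = Vec.zipWith-comm ℤₚ.+-comm

ε₀-εⱼ : ∀ {n} (j : Fin n) → ε zero -ᵛ ε (suc j) ≡ edge (here j)
ε₀-εⱼ j = cong (1ℤ ∷_) (+ᵛ-identityˡ _)

ε₀+εⱼ : ∀ {n} (j : Fin n) → ε zero +ᵛ ε (suc j) ≡ castᵛ (endpoints (link j))
ε₀+εⱼ j = cong (1ℤ ∷_) (trans (+ᵛ-identityˡ _) (sym (cast-unit j)))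

ε₀+ε₀ : ∀ {n} → ε zero +ᵛ ε zero ≡ castᵛ (endpoints (loop {n}))
ε₀+ε₀ {n} = cong ((+ 2) ∷_) (trans (+ᵛ-identityˡ _) (sym (cast-zeros n)))

positive-∷ : ∀ {n} {u : Vec ℤ n} → PositiveRoot u → PositiveRoot (0ℤ ∷ u)
positive-∷ (ε-ε i<j) = ε-ε (s≤s i<j)
positive-∷ (ε+ε i<j) = ε+ε (s≤s i<j)
positive-∷ (2ε i)    = 2ε (suc i)

vec-positive : ∀ {n} (ρ : Root n) → PositiveRoot (vec ρ)
vec-positive (inj₁ (here j))  = subst PositiveRoot (ε₀-εⱼ j) (ε-ε z<s)
vec-positive (inj₁ (there e)) = positive-∷ (vec-positive (inj₁ e))
vec-positive (inj₂ loop)      = subst PositiveRoot ε₀+ε₀ (2ε zero)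
vec-positive (inj₂ (link j))  = subst PositiveRoot (ε₀+εⱼ j) (ε+ε z<s)
vec-positive (inj₂ (there p)) = positive-∷ (vec-positive (inj₂ p))

difference : ∀ {n} {i j : Fin n} → i Fin.< j → ∃ λ e → edge e ≡ ε i -ᵛ ε j
difference {i = zero}  {suc j} _         = here j , sym (ε₀-εⱼ j)
difference {i = suc i} {suc j} (s≤s i<j) with e , eq ← difference i<j = there e , cong (0ℤ ∷_) eq

-- The weak inequality treats the roots ε_i + ε_j and 2ε_i together.
sum-of-two : ∀ {n} (i j : Fin n) → i Fin.≤ j → ∃ λ p → castᵛ (endpoints p) ≡ ε i +ᵛ ε j
sum-of-two zero    zero    _         = loop , sym ε₀+ε₀
sum-of-two zero    (suc j) _         = link j , sym (ε₀+εⱼ j)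
sum-of-two (suc i) (suc j) (s≤s i≤j) with p , eq ← sum-of-two i j i≤j = there p , cong (0ℤ ∷_) eq

positive⇒vec : ∀ {n} {u : Vec ℤ n} → PositiveRoot u → ∃ λ ρ → vec ρ ≡ u
positive⇒vec (ε-ε i<j) with e , eq ← difference i<j               = inj₁ e , eq
positive⇒vec (ε+ε i<j) with p , eq ← sum-of-two _ _ (<⇒≤ i<j)     = inj₂ p , eq
positive⇒vec (2ε i)    with p , eq ← sum-of-two i i (≤-refl)      = inj₂ p , eq

All-positive⇒vec : ∀ {n} {us : List (Vec ℤ n)} → All PositiveRoot us →
                   ∃ λ ρs → List.map vec ρs ≡ us
All-positive⇒vec []       = [] , refl
All-positive⇒vec (p ∷ ps) with positive⇒vec p | All-positive⇒vec ps
... | ρ , refl | ρs , refl = ρ ∷ ρs , refl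

-- Coordinate sums

negᵛ-+ᵛ : ∀ {n} (u v : Vec ℤ n) → Vec.map -_ (u +ᵛ v) ≡ Vec.map -_ u +ᵛ Vec.map -_ v
negᵛ-+ᵛ []      []      = refl
negᵛ-+ᵛ (x ∷ u) (y ∷ v) = cong₂ _∷_ (ℤₚ.neg-distrib-+ x y) (negᵛ-+ᵛ u v)

total : ∀ {n} → Vec ℤ n → ℤ
total []      = 0ℤ
total (x ∷ u) = x ℤ.+ total u

total-+ᵛ : ∀ {n} (u v : Vec ℤ n) → total (u +ᵛ v) ≡ total u ℤ.+ total v
total-+ᵛ []      []      = refl
total-+ᵛ (x ∷ u) (y ∷ v) =
  trans (cong (ℤ._+_ (x ℤ.+ y)) (total-+ᵛ u v)) (interchange ℤₚ.+-commutativeSemigroup x y (total u) (total v))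

total-neg : ∀ {n} (u : Vec ℤ n) → total (Vec.map -_ u) ≡ - total u
total-neg []      = refl
total-neg (x ∷ u) = trans (cong (ℤ._+_ (- x)) (total-neg u)) (sym (ℤₚ.neg-distrib-+ x (total u)))

total-cast : ∀ {n} (v : Vec ℕ n) → total (castᵛ v) ≡ + Vec.sum v
total-cast []      = refl
total-cast (a ∷ v) = cong (ℤ._+_ (+ a)) (total-cast v)

sum-zeros : ∀ n → Vec.sum (replicate n 0) ≡ 0
sum-zeros zero    = refl
sum-zeros (suc n) = sum-zeros n

sum-unit : ∀ {n} (i : Fin n) → Vec.sum (unit i) ≡ 1
sum-unit {suc n} zero    = cong suc (sum-zeros n)
sum-unit         (suc i) = sum-unit i

sum-endpoints : ∀ {n} (p : Pair n) → Vec.sum (endpoints p) ≡ 2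
sum-endpoints (loop {n}) = cong (λ s → 2 + s) (sum-zeros n)
sum-endpoints (link j)   = cong suc (sum-unit j)
sum-endpoints (there p)  = sum-endpoints p

total-edge : ∀ {n} (e : Edge n) → total (edge e) ≡ 0ℤ
total-edge (here j) = begin
  1ℤ ℤ.+ total (Vec.map -_ (ε j))  ≡⟨ cong (ℤ._+_ 1ℤ) (total-neg (ε j)) ⟩
  1ℤ ℤ.- total (ε j)               ≡⟨ cong (λ u → 1ℤ ℤ.- total u) (cast-unit j) ⟨
  1ℤ ℤ.- total (castᵛ (unit j))    ≡⟨ cong (ℤ._-_ 1ℤ) (total-cast (unit j)) ⟩
  1ℤ ℤ.- + Vec.sum (unit j)        ≡⟨ cong (λ s → 1ℤ ℤ.- + s) (sum-unit j) ⟩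
  0ℤ                               ∎
  where open ≡-Reasoning
total-edge (there e) = trans (ℤₚ.+-identityˡ _) (total-edge e)

total-pair : ∀ {n} (p : Pair n) → total (castᵛ (endpoints p)) ≡ + 2
total-pair p = trans (total-cast (endpoints p)) (cong +_ (sum-endpoints p))

-- Injectivity of the parametrization of the roots

castᵛ-injective : ∀ {n} {u v : Vec ℕ n} → castᵛ u ≡ castᵛ v → u ≡ v
castᵛ-injective {u = []}    {[]}    _  = refl
castᵛ-injective {u = _ ∷ _} {_ ∷ _} eq =
  cong₂ _∷_ (ℤₚ.+-injective (∷-injectiveˡ eq)) (castᵛ-injective (∷-injectiveʳ eq))

negᵛ-injective : ∀ {n} {u v : Vec ℤ n} → Vec.map -_ u ≡ Vec.map -_ v → u ≡ v
negᵛ-injective {u = []}    {[]}    _  = refl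
negᵛ-injective {u = _ ∷ _} {_ ∷ _} eq =
  cong₂ _∷_ (ℤₚ.neg-injective (∷-injectiveˡ eq)) (negᵛ-injective (∷-injectiveʳ eq))

ε-injective : ∀ {n} {i j : Fin n} → ε i ≡ ε j → i ≡ j
ε-injective {i = zero}  {zero}  _  = refl
ε-injective {i = suc i} {suc j} eq = cong suc (ε-injective (∷-injectiveʳ eq))

edge-injective : ∀ {n} {e e′ : Edge n} → edge e ≡ edge e′ → e ≡ e′
edge-injective {e = here i}  {here j}   eq =
  cong here (ε-injective (negᵛ-injective (∷-injectiveʳ eq)))
edge-injective {e = there e} {there e′} eq = cong there (edge-injective (∷-injectiveʳ eq))

endpoints-injective : ∀ {n} {p p′ : Pair n} → endpoints p ≡ endpoints p′ → p ≡ p′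
endpoints-injective {p = loop}    {loop}     _  = refl
endpoints-injective {p = link i}  {link j}   eq =
  cong link (ε-injective (trans (sym (cast-unit i))
    (trans (cong castᵛ (∷-injectiveʳ eq)) (cast-unit j))))
endpoints-injective {p = there p} {there p′} eq = cong there (endpoints-injective (∷-injectiveʳ eq))

edge≢pair : ∀ {n} (e : Edge n) (p : Pair n) → edge e ≢ castᵛ (endpoints p)
edge≢pair e p eq with () ← trans (sym (total-edge e)) (trans (cong total eq) (total-pair p))

-- Partitions are compared as multisets of vectors; this carries a permutation of vectors back to
-- the labels. Edges and pairs never collide, their coordinate sums being 0 and 2.
vec-injective : ∀ {n} {ρ σ : Root n} → vec ρ ≡ vec σ → ρ ≡ σ
vec-injective {ρ = inj₁ e} {inj₁ e′} eq = cong inj₁ (edge-injective eq)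
vec-injective {ρ = inj₁ e} {inj₂ p}  eq = contradiction eq (edge≢pair e p)
vec-injective {ρ = inj₂ p} {inj₁ e}  eq = contradiction (sym eq) (edge≢pair e p)
vec-injective {ρ = inj₂ p} {inj₂ p′} eq = cong inj₂ (endpoints-injective (castᵛ-injective eq))

map-↭-injective : ∀ {A B : Set} {f : A → B} → (∀ {x y} → f x ≡ f y → x ≡ y) →
                  ∀ {xs ys} → List.map f xs ↭ List.map f ys → xs ↭ ys
map-↭-injective {f = f} inj p with zs , eq , q ← ↭-map-inv f p =
  subst (_ ↭_) (sym (List.map-injective inj eq)) q

zeros-unique : ∀ {n} (d : Vec ℕ n) → Vec.sum d ≡ 0 → replicate n 0 ≡ d
zeros-unique []         _ = refl
zeros-unique (zero ∷ d) p = cong (0 ∷_) (zeros-unique d p)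

unit-surjective : ∀ {n} (d : Vec ℕ n) → Vec.sum d ≡ 1 → ∃ λ i → unit i ≡ d
unit-surjective (zero ∷ d)     p with i , eq ← unit-surjective d p = suc i , cong (0 ∷_) eq
unit-surjective (suc zero ∷ d) p = zero , cong (1 ∷_) (zeros-unique d (suc-injective p))

-- The first nonzero entry is 2, giving a loop, or 1, leaving a single further unit. This turns the
-- sink edges of a flow of value 2 back into one root.
endpoints-surjective : ∀ {n} (d : Vec ℕ n) → Vec.sum d ≡ 2 → ∃ λ p → endpoints p ≡ d
endpoints-surjective (zero ∷ d) q with p , eq ← endpoints-surjective d q = there p , cong (0 ∷_) eq
endpoints-surjective (suc zero ∷ d) q
  with j , eq ← unit-surjective d (suc-injective q) = link j , cong (1 ∷_) eq
endpoints-surjective (suc (suc zero) ∷ d) q =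
  loop , cong (2 ∷_) (zeros-unique d (suc-injective (suc-injective q)))

-- Multisets of edges as triangles of multiplicities

-- Folding a left-commutative operation depends only on the multiset. It is used both for counting
-- edges and for summing vectors.
foldr-↭ : ∀ {A B : Set} (f : A → B → B) → (∀ x y b → f x (f y b) ≡ f y (f x b)) →
          ∀ b {xs ys} → xs ↭ ys → List.foldr f b xs ≡ List.foldr f b ys
foldr-↭ f comm b _↭_.refl         = refl
foldr-↭ f comm b (prep x p)   = cong (f x) (foldr-↭ f comm b p)
foldr-↭ f comm b (swap x y p) =
  trans (comm x y _) (cong (λ b → f y (f x b)) (foldr-↭ f comm b p))
foldr-↭ f comm b (_↭_.trans p q) = trans (foldr-↭ f comm b p) (foldr-↭ f comm b q)

fromRow : ∀ {n} → Vec ℕ n → List (Fin n)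
fromRow []      = []
fromRow (x ∷ c) = List.replicate x zero ++ List.map suc (fromRow c)

fromTriangle : ∀ {n} → Triangle n → List (Edge n)
fromTriangle []      = []
fromTriangle (c ◁ T) = List.map there (fromTriangle T) ++ List.map here (fromRow c)

incr : ∀ {n} → Fin n → Vec ℕ n → Vec ℕ n
incr i c = Vec.updateAt c i suc

insert : ∀ {n} → Edge n → Triangle n → Triangle n
insert (here j)  (c ◁ T) = incr j c ◁ T
insert (there e) (c ◁ T) = c ◁ insert e T

incr-comm : ∀ {n} (i j : Fin n) c → incr i (incr j c) ≡ incr j (incr i c)
incr-comm zero    zero    (x ∷ c) = refl
incr-comm zero    (suc j) (x ∷ c) = refl
incr-comm (suc i) zero    (x ∷ c) = refl
incr-comm (suc i) (suc j) (x ∷ c) = cong (x ∷_) (incr-comm i j c)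

insert-comm : ∀ {n} (e f : Edge n) T → insert e (insert f T) ≡ insert f (insert e T)
insert-comm (here i)  (here j)  (c ◁ T) = cong (_◁ T) (incr-comm i j c)
insert-comm (here i)  (there f) (c ◁ T) = refl
insert-comm (there e) (here j)  (c ◁ T) = refl
insert-comm (there e) (there f) (c ◁ T) = cong (c ◁_) (insert-comm e f T)

fromRow-incr : ∀ {n} (i : Fin n) c → fromRow (incr i c) ↭ i ∷ fromRow c
fromRow-incr zero    (x ∷ c) = ↭-refl
fromRow-incr (suc i) (x ∷ c) =
  ↭-trans (++⁺ˡ (List.replicate x zero) (map⁺ suc (fromRow-incr i c)))
          (shift (suc i) (List.replicate x zero) _)

fromTriangle-insert : ∀ {n} (e : Edge n) T → fromTriangle (insert e T) ↭ e ∷ fromTriangle T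
fromTriangle-insert (here j) (c ◁ T) =
  ↭-trans (++⁺ˡ (List.map there (fromTriangle T)) (map⁺ here (fromRow-incr j c)))
          (shift (here j) (List.map there (fromTriangle T)) _)
fromTriangle-insert (there e) (c ◁ T) =
  ++⁺ʳ (List.map here (fromRow c)) (map⁺ there (fromTriangle-insert e T))

empty : ∀ n → Triangle n
empty zero    = []
empty (suc n) = replicate n 0 ◁ empty n

fromRow-zeros : ∀ n → fromRow (replicate n 0) ≡ []
fromRow-zeros zero    = refl
fromRow-zeros (suc n) = cong (List.map suc) (fromRow-zeros n)

fromTriangle-empty : ∀ n → fromTriangle (empty n) ≡ []
fromTriangle-empty zero    = refl
fromTriangle-empty (suc n) =
  cong₂ (λ es is → List.map there es ++ List.map here is) (fromTriangle-empty n) (fromRow-zeros n)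

incrs-zero : ∀ {n} x y (c : Vec ℕ n) →
             List.foldr incr (y ∷ c) (List.replicate x zero) ≡ (x + y) ∷ c
incrs-zero zero    y c = refl
incrs-zero (suc x) y c = cong (incr zero) (incrs-zero x y c)

incrs-suc : ∀ {n} x (c : Vec ℕ n) is →
            List.foldr incr (x ∷ c) (List.map suc is) ≡ x ∷ List.foldr incr c is
incrs-suc x c []       = refl
incrs-suc x c (i ∷ is) = cong (incr (suc i)) (incrs-suc x c is)

incrs-fromRow : ∀ {n} (c : Vec ℕ n) → List.foldr incr (replicate n 0) (fromRow c) ≡ c
incrs-fromRow             []      = refl
incrs-fromRow {n = suc n} (x ∷ c) = begin
  List.foldr incr (replicate (suc n) 0) (fromRow (x ∷ c))
    ≡⟨ List.foldr-++ incr _ (List.replicate x zero) _ ⟩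
  List.foldr incr (List.foldr incr (replicate (suc n) 0) (List.map suc (fromRow c))) zeros
    ≡⟨ cong (λ c → List.foldr incr c zeros) (incrs-suc 0 _ (fromRow c)) ⟩
  List.foldr incr (0 ∷ List.foldr incr (replicate n 0) (fromRow c)) zeros
    ≡⟨ incrs-zero x 0 _ ⟩
  (x + 0) ∷ List.foldr incr (replicate n 0) (fromRow c)
    ≡⟨ cong₂ _∷_ (+-identityʳ x) (incrs-fromRow c) ⟩
  x ∷ c
    ∎
  where
  open ≡-Reasoning
  zeros = List.replicate x zero

inserts-there : ∀ {n} (c : Vec ℕ n) T es →
                List.foldr insert (c ◁ T) (List.map there es) ≡ c ◁ List.foldr insert T es
inserts-there c T []       = refl
inserts-there c T (e ∷ es) = cong (insert (there e)) (inserts-there c T es)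

inserts-here : ∀ {n} (c : Vec ℕ n) T is →
               List.foldr insert (c ◁ T) (List.map here is) ≡ List.foldr incr c is ◁ T
inserts-here c T []       = refl
inserts-here c T (i ∷ is) = cong (insert (here i)) (inserts-here c T is)

-- Counting the canonical list returns the multiplicities. As counting ignores order, triangles with
-- permuted lists coincide.
inserts-fromTriangle : ∀ {n} (T : Triangle n) → List.foldr insert (empty n) (fromTriangle T) ≡ T
inserts-fromTriangle []      = refl
inserts-fromTriangle {suc n} (c ◁ T) = begin
  List.foldr insert (empty (suc n)) (fromTriangle (c ◁ T))
    ≡⟨ List.foldr-++ insert _ (List.map there (fromTriangle T)) _ ⟩
  List.foldr insert (List.foldr insert (empty (suc n)) (List.map here (fromRow c))) theres
    ≡⟨ cong (λ T → List.foldr insert T theres) (inserts-here _ _ (fromRow c)) ⟩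
  List.foldr insert (List.foldr incr (replicate n 0) (fromRow c) ◁ empty n) theres
    ≡⟨ inserts-there _ _ (fromTriangle T) ⟩
  List.foldr incr (replicate n 0) (fromRow c) ◁ List.foldr insert (empty n) (fromTriangle T)
    ≡⟨ cong₂ _◁_ (incrs-fromRow c) (inserts-fromTriangle T) ⟩
  c ◁ T
    ∎
  where
  open ≡-Reasoning
  theres = List.map there (fromTriangle T)

-- Pairs are skipped, so that folding over a whole partition counts just its edges.
insertRoot : ∀ {n} → Root n → Triangle n → Triangle n
insertRoot (inj₁ e) T = insert e T
insertRoot (inj₂ _) T = T

insertRoot-comm : ∀ {n} (ρ σ : Root n) T →
                  insertRoot ρ (insertRoot σ T) ≡ insertRoot σ (insertRoot ρ T)
insertRoot-comm (inj₁ e) (inj₁ f) T = insert-comm e f T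
insertRoot-comm (inj₁ e) (inj₂ q) T = refl
insertRoot-comm (inj₂ p) (inj₁ f) T = refl
insertRoot-comm (inj₂ p) (inj₂ q) T = refl

roots : ∀ {n} → List (Pair n) → Triangle n → List (Root n)
roots ps T = List.map inj₂ ps ++ List.map inj₁ (fromTriangle T)

roots-injective : ∀ {n} (p p′ : Pair n) T T′ → roots (p ∷ []) T ↭ roots (p′ ∷ []) T′ → T ≡ T′
roots-injective {n} p p′ T T′ perm =
  trans (sym (recover T)) (trans (foldr-↭ insertRoot insertRoot-comm (empty n) perm) (recover T′))
  where
  recover : ∀ T → List.foldr insertRoot (empty n) (List.map inj₁ (fromTriangle T)) ≡ T
  recover T = trans (List.foldr-map insertRoot inj₁ (empty n) (fromTriangle T))
                    (inserts-fromTriangle T)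

-- Pairs move to the front and edges into canonical order. How many pairs occur is left open, since
-- only the sum of the parts decides it.
roots-surjective : ∀ {n} (ρs : List (Root n)) → ∃₂ λ ps T → ρs ↭ roots ps T
roots-surjective {n} [] =
  [] , empty n , ↭-reflexive (cong (List.map inj₁) (sym (fromTriangle-empty n)))
roots-surjective (inj₁ e ∷ ρs) with ps , T , perm ← roots-surjective ρs =
  ps , insert e T , (begin
    inj₁ e ∷ ρs                                                 ↭⟨ prep _ perm ⟩
    inj₁ e ∷ roots ps T                                         ↭⟨ shift _ (List.map inj₂ ps) _ ⟨
    List.map inj₂ ps ++ List.map inj₁ (e ∷ fromTriangle T)      ↭⟨ ++⁺ˡ (List.map inj₂ ps)
                                                                     (map⁺ inj₁ (fromTriangle-insert e T)) ⟨
    roots ps (insert e T)                                       ∎)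
  where open PermutationReasoning
roots-surjective (inj₂ p ∷ ρs) with ps , T , perm ← roots-surjective ρs = p ∷ ps , T , prep _ perm

-- Conservation of flow

sumᵛ-++ : ∀ {n} (us vs : List (Vec ℤ n)) → sumᵛ (us ++ vs) ≡ sumᵛ us +ᵛ sumᵛ vs
sumᵛ-++ []       vs = sym (+ᵛ-identityˡ _)
sumᵛ-++ (u ∷ us) vs = trans (cong (u +ᵛ_) (sumᵛ-++ us vs)) (sym (+ᵛ-assoc u _ _))

sumᵛ-↭ : ∀ {n} {us vs : List (Vec ℤ n)} → us ↭ vs → sumᵛ us ≡ sumᵛ vs
sumᵛ-↭ = foldr-↭ _+ᵛ_ (λ u v w → begin
  u +ᵛ (v +ᵛ w)  ≡⟨ +ᵛ-assoc u v w ⟨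
  (u +ᵛ v) +ᵛ w  ≡⟨ cong (_+ᵛ w) (+ᵛ-comm u v) ⟩
  (v +ᵛ u) +ᵛ w  ≡⟨ +ᵛ-assoc v u w ⟩
  v +ᵛ (u +ᵛ w)  ∎) 0ᵛ
  where open ≡-Reasoning

-- Outflow minus inflow at each vertex, counting only edges that avoid the sink.
net : ∀ {n} → Triangle n → Vec ℤ n
net T = sumᵛ (List.map edge (fromTriangle T))

sumᵛ-map-∷ : ∀ {A : Set} {n} (f : A → Vec ℤ n) xs →
             sumᵛ (List.map (λ x → 0ℤ ∷ f x) xs) ≡ 0ℤ ∷ sumᵛ (List.map f xs)
sumᵛ-map-∷ f []       = refl
sumᵛ-map-∷ f (x ∷ xs) = cong ((0ℤ ∷ f x) +ᵛ_) (sumᵛ-map-∷ f xs)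

sumᵛ-ε₀ : ∀ {n} x → sumᵛ (List.map ε (List.replicate x zero)) ≡ + x ∷ 0ᵛ {n}
sumᵛ-ε₀ zero    = refl
sumᵛ-ε₀ (suc x) = trans (cong (ε zero +ᵛ_) (sumᵛ-ε₀ x)) (cong (+ suc x ∷_) (+ᵛ-identityˡ 0ᵛ))

sumᵛ-fromRow : ∀ {n} (c : Vec ℕ n) → sumᵛ (List.map ε (fromRow c)) ≡ castᵛ c
sumᵛ-fromRow []      = refl
sumᵛ-fromRow (x ∷ c) = begin
  sumᵛ (List.map ε (zeros ++ List.map suc (fromRow c)))
    ≡⟨ cong sumᵛ (List.map-++ ε zeros _) ⟩
  sumᵛ (List.map ε zeros ++ List.map ε (List.map suc (fromRow c)))
    ≡⟨ sumᵛ-++ (List.map ε zeros) _ ⟩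
  sumᵛ (List.map ε zeros) +ᵛ sumᵛ (List.map ε (List.map suc (fromRow c)))
    ≡⟨ cong₂ _+ᵛ_ (sumᵛ-ε₀ x) (cong sumᵛ (sym (List.map-∘ (fromRow c)))) ⟩
  (+ x ∷ 0ᵛ) +ᵛ sumᵛ (List.map (λ i → 0ℤ ∷ ε i) (fromRow c))
    ≡⟨ cong ((+ x ∷ 0ᵛ) +ᵛ_) (trans (sumᵛ-map-∷ ε (fromRow c)) (cong (0ℤ ∷_) (sumᵛ-fromRow c))) ⟩
  (+ x ∷ 0ᵛ) +ᵛ (0ℤ ∷ castᵛ c)
    ≡⟨ cong₂ _∷_ (ℤₚ.+-identityʳ (+ x)) (+ᵛ-identityˡ (castᵛ c)) ⟩
  castᵛ (x ∷ c)
    ∎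
  where
  open ≡-Reasoning
  zeros = List.replicate x zero

sumᵛ-here : ∀ {n} (is : List (Fin n)) →
            sumᵛ (List.map (edge ∘ here) is) ≡ + List.length is ∷ Vec.map -_ (sumᵛ (List.map ε is))
sumᵛ-here {n} []   = cong (0ℤ ∷_) (sym (Vec.map-replicate -_ 0ℤ n))
sumᵛ-here (i ∷ is) =
  trans (cong (edge (here i) +ᵛ_) (sumᵛ-here is))
        (cong (+ suc (List.length is) ∷_) (sym (negᵛ-+ᵛ (ε i) _)))

length-fromRow : ∀ {n} (c : Vec ℕ n) → List.length (fromRow c) ≡ Vec.sum c
length-fromRow []      = refl
length-fromRow (x ∷ c) = begin
  List.length (List.replicate x zero ++ List.map suc (fromRow c))
    ≡⟨ List.length-++ (List.replicate x zero) ⟩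
  List.length (List.replicate x zero) + List.length (List.map suc (fromRow c))
    ≡⟨ cong₂ _+_ (List.length-replicate x) (List.length-map suc (fromRow c)) ⟩
  x + List.length (fromRow c)
    ≡⟨ cong (_+_ x) (length-fromRow c) ⟩
  x + Vec.sum c
    ∎
  where open ≡-Reasoning

-- No edge enters the first vertex, so its coordinate is its outflow; each later vertex receives its
-- entry of `c`, counted negatively.
net-◁ : ∀ {n} (c : Vec ℕ n) T → net (c ◁ T) ≡ + Vec.sum c ∷ (net T -ᵛ castᵛ c)
net-◁ c T = begin
  sumᵛ (List.map edge (List.map there (fromTriangle T) ++ List.map here (fromRow c)))
    ≡⟨ cong sumᵛ (List.map-++ edge (List.map there (fromTriangle T)) _) ⟩
  sumᵛ (List.map edge (List.map there (fromTriangle T)) ++ List.map edge (List.map here (fromRow c)))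
    ≡⟨ sumᵛ-++ (List.map edge (List.map there (fromTriangle T))) _ ⟩
  sumᵛ (List.map edge (List.map there (fromTriangle T))) +ᵛ
  sumᵛ (List.map edge (List.map here (fromRow c)))
    ≡⟨ cong₂ (λ us vs → sumᵛ us +ᵛ sumᵛ vs) (List.map-∘ (fromTriangle T)) (List.map-∘ (fromRow c)) ⟨
  sumᵛ (List.map (edge ∘ there) (fromTriangle T)) +ᵛ sumᵛ (List.map (edge ∘ here) (fromRow c))
    ≡⟨ cong₂ _+ᵛ_ (sumᵛ-map-∷ edge (fromTriangle T)) (sumᵛ-here (fromRow c)) ⟩
  (0ℤ ∷ net T) +ᵛ (+ List.length (fromRow c) ∷ Vec.map -_ (sumᵛ (List.map ε (fromRow c))))
    ≡⟨ cong₂ (λ l u → + l ∷ (net T -ᵛ u)) (length-fromRow c) (sumᵛ-fromRow c) ⟩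
  + Vec.sum c ∷ (net T -ᵛ castᵛ c)
    ∎
  where open ≡-Reasoning

-- Units arriving from a deleted vertex are inflow in the recursive conservation law and negative
-- net outflow in the linear one; this passes between the two accounts.
transpose⁺ : ∀ {n} (x y : Vec ℤ n) (v c : Vec ℕ n) →
             x +ᵛ y ≡ castᵛ (v ⊕ c) → x +ᵛ (y -ᵛ castᵛ c) ≡ castᵛ v
transpose⁺ []      []      []      []      _  = refl
transpose⁺ (i ∷ x) (j ∷ y) (a ∷ v) (b ∷ c) eq = cong₂ _∷_
  (trans (sym (ℤₚ.+-assoc i j (- + b)))
    (trans (cong (ℤ._- + b) (∷-injectiveˡ eq)) (cancel (+ a) (+ b))))
  (transpose⁺ x y v c (∷-injectiveʳ eq))
  where
  cancel : ∀ k l → k ℤ.+ l ℤ.+ - l ≡ k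
  cancel = solve-∀

transpose⁻ : ∀ {n} (x y : Vec ℤ n) (v c : Vec ℕ n) →
             x +ᵛ (y -ᵛ castᵛ c) ≡ castᵛ v → x +ᵛ y ≡ castᵛ (v ⊕ c)
transpose⁻ []      []      []      []      _  = refl
transpose⁻ (i ∷ x) (j ∷ y) (a ∷ v) (b ∷ c) eq = cong₂ _∷_
  (trans (expand i j (+ b)) (cong (ℤ._+ + b) (∷-injectiveˡ eq)))
  (transpose⁻ x y v c (∷-injectiveʳ eq))
  where
  expand : ∀ k l m → k ℤ.+ l ≡ k ℤ.+ (l ℤ.+ - m) ℤ.+ m
  expand = solve-∀

-- Conservation vertex by vertex amounts to one vector equation, which has the form of the sum
-- condition on a partition.
flow⇒net : ∀ {n} (v : Vec ℕ n) T ds → IsFlow v T ds → castᵛ ds +ᵛ net T ≡ castᵛ v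
flow⇒net []      []      []       _       = refl
flow⇒net (a ∷ v) (c ◁ T) (d ∷ ds) (p , f) = trans (cong (castᵛ (d ∷ ds) +ᵛ_) (net-◁ c T))
  (cong₂ _∷_ (cong +_ p) (transpose⁺ (castᵛ ds) (net T) v c (flow⇒net (v ⊕ c) T ds f)))

net⇒flow : ∀ {n} (v : Vec ℕ n) T ds → castᵛ ds +ᵛ net T ≡ castᵛ v → IsFlow v T ds
net⇒flow []      []      []       _  = tt
net⇒flow (a ∷ v) (c ◁ T) (d ∷ ds) eq =
  let p , q = ∷-injective (trans (cong (castᵛ (d ∷ ds) +ᵛ_) (sym (net-◁ c T))) eq)
  in ℤₚ.+-injective p , net⇒flow (v ⊕ c) T ds (transpose⁻ (castᵛ ds) (net T) v c q)

total-sumᵛ : ∀ {A : Set} {n} (f : A → Vec ℤ n) k → (∀ x → total (f x) ≡ + k) →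
             ∀ xs → total (sumᵛ (List.map f xs)) ≡ + (List.length xs * k)
total-sumᵛ {n = n} f k eq []       =
  trans (cong total (sym (cast-zeros n))) (trans (total-cast (replicate n 0)) (cong +_ (sum-zeros n)))
total-sumᵛ f k eq (x ∷ xs) =
  trans (total-+ᵛ (f x) _) (cong₂ ℤ._+_ (eq x) (total-sumᵛ f k eq xs))

total-net : ∀ {n} (T : Triangle n) → total (net T) ≡ 0ℤ
total-net T = trans (total-sumᵛ edge 0 total-edge (fromTriangle T))
                    (cong +_ (*-zeroʳ (List.length (fromTriangle T))))

-- Every edge between non-sink vertices has coordinate sum 0, so the total inflow must leave through
-- the sink.
flow-sum : ∀ {n} (v : Vec ℕ n) T ds → IsFlow v T ds → Vec.sum ds ≡ Vec.sum v
flow-sum v T ds f = ℤₚ.+-injective (begin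
  + Vec.sum ds                           ≡⟨ total-cast ds ⟨
  total (castᵛ ds)                       ≡⟨ ℤₚ.+-identityʳ _ ⟨
  total (castᵛ ds) ℤ.+ 0ℤ                ≡⟨ cong (ℤ._+_ (total (castᵛ ds))) (total-net T) ⟨
  total (castᵛ ds) ℤ.+ total (net T)     ≡⟨ total-+ᵛ (castᵛ ds) (net T) ⟨
  total (castᵛ ds +ᵛ net T)              ≡⟨ cong total (flow⇒net v T ds f) ⟩
  total (castᵛ v)                        ≡⟨ total-cast v ⟩
  + Vec.sum v                            ∎)
  where open ≡-Reasoning

-- Partitions

pairSum : ∀ {n} → List (Pair n) → Vec ℤ n
pairSum ps = sumᵛ (List.map (castᵛ ∘ endpoints) ps)

sumᵛ-roots : ∀ {n} (ps : List (Pair n)) T → sumᵛ (List.map vec (roots ps T)) ≡ pairSum ps +ᵛ net T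
sumᵛ-roots ps T = begin
  sumᵛ (List.map vec (List.map inj₂ ps ++ List.map inj₁ (fromTriangle T)))
    ≡⟨ cong sumᵛ (List.map-++ vec (List.map inj₂ ps) _) ⟩
  sumᵛ (List.map vec (List.map inj₂ ps) ++ List.map vec (List.map inj₁ (fromTriangle T)))
    ≡⟨ cong₂ (λ us vs → sumᵛ (us ++ vs)) (List.map-∘ ps) (List.map-∘ (fromTriangle T)) ⟨
  sumᵛ (List.map (castᵛ ∘ endpoints) ps ++ List.map edge (fromTriangle T))
    ≡⟨ sumᵛ-++ (List.map (castᵛ ∘ endpoints) ps) _ ⟩
  pairSum ps +ᵛ net T
    ∎
  where open ≡-Reasoning

length-1 : ∀ {A : Set} (xs : List A) → List.length xs ≡ 1 → ∃ λ x → xs ≡ x ∷ []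
length-1 (x ∷ []) refl = x , refl

one-pair : ∀ {n} (v : Vec ℕ n) ps T → Vec.sum v ≡ 2 → pairSum ps +ᵛ net T ≡ castᵛ v →
           ∃ λ p → ps ≡ p ∷ []
one-pair v ps T v≡2 eq = length-1 ps (*-cancelʳ-≡ (List.length ps) 1 2 (ℤₚ.+-injective (begin
  + (List.length ps * 2)                ≡⟨ total-sumᵛ _ 2 total-pair ps ⟨
  total (pairSum ps)                    ≡⟨ ℤₚ.+-identityʳ _ ⟨
  total (pairSum ps) ℤ.+ 0ℤ             ≡⟨ cong (ℤ._+_ (total (pairSum ps))) (total-net T) ⟨
  total (pairSum ps) ℤ.+ total (net T)  ≡⟨ total-+ᵛ (pairSum ps) (net T) ⟨
  total (pairSum ps +ᵛ net T)           ≡⟨ cong total eq ⟩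
  total (castᵛ v)                       ≡⟨ total-cast v ⟩
  + Vec.sum v                           ≡⟨ cong +_ v≡2 ⟩
  + 2                                   ∎)))
  where open ≡-Reasoning

module FlowPartition {n} (v : Vec ℕ n) (v≡2 : Vec.sum v ≡ 2) where

  lastPair : ∀ {T ds} → IsFlow v T ds → ∃ λ p → endpoints p ≡ ds
  lastPair {T} {ds} f = endpoints-surjective ds (trans (flow-sum v T ds f) v≡2)

  partition : Flow v → Partition (castᵛ v)
  partition (T , ds , f) = record
    { parts    = List.map vec (roots (proj₁ (lastPair f) ∷ []) T)
    ; positive = All.map⁺ (All.universal vec-positive (roots (proj₁ (lastPair f) ∷ []) T))
    ; sums-to  = trans (sumᵛ-roots (proj₁ (lastPair f) ∷ []) T)
        (trans (cong (_+ᵛ net T) (trans (+ᵛ-identityʳ _) (cong castᵛ (proj₂ (lastPair f)))))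
               (flow⇒net v T ds f))
    }

  -- The permuted parts determine the triangle, and the triangle determines the sink edges; the
  -- pairs themselves are never compared.
  partition-injective : ∀ x y → Partition.parts (partition x) ↭ Partition.parts (partition y) →
                        x ≡ y
  partition-injective (T , ds , f) (T′ , ds′ , f′) perm
    with refl ← roots-injective _ _ T T′ (map-↭-injective vec-injective perm) =
    Flow-≡ refl (IsFlow-functional v T ds ds′ f f′)

  partition-surjective : ∀ π → ∃ λ x → Partition.parts (partition x) ↭ Partition.parts π
  partition-surjective record { parts = us ; positive = us⁺ ; sums-to = us-sum }
    with ρs , refl ← All-positive⇒vec us⁺
    with ps , T , perm ← roots-surjective ρs
    with eq ← trans (sym (sumᵛ-roots ps T)) (trans (sym (sumᵛ-↭ (map⁺ vec perm))) us-sum)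
    with p , refl ← one-pair v ps T v≡2 eq =
    let f = net⇒flow v T (endpoints p) (trans (cong (_+ᵛ net T) (sym (+ᵛ-identityʳ _))) eq)
    in (T , endpoints p , f) ,
       -- The pair that `lastPair` extracts from the sink edges is not syntactically `p`, but has
       -- the same endpoints.
       subst (λ q → List.map vec (roots (q ∷ []) T) ↭ List.map vec ρs)
         (sym (endpoints-injective (proj₂ (lastPair f)))) (↭-sym (map⁺ vec perm))

  flow⤖partition : Bijection (setoid (Flow v)) (Partitions (castᵛ v))
  flow⤖partition = record
    { to        = partition
    ; cong      = λ { refl → ↭-refl }
    ; bijective =
        (λ {x} {y} → partition-injective x y)
      , λ π → let x , perm = partition-surjective π in x , λ { refl → perm }
    }

mainTheorem12 : (r : ℕ) (3≤r : 3 ≤ r) →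
    Bijection (Partitions (highestRoot (m<n⇒0<n 3≤r))) (JS ⟨ + 2 ∷ [] ⟩ ⟨ + 2 ∷ [] ⟩ r)
    × ∃₂ λ (K js : ℕ) →
    HasCardinality (Partitions (highestRoot (m<n⇒0<n 3≤r))) K
    × HasCardinality (JS ⟨ + 2 ∷ [] ⟩ ⟨ + 2 ∷ [] ⟩ r) js
    × K ≡ js
mainTheorem12 (suc r) (s≤s 2≤r) =
    Bijection.trans partition⤖flow juggling
  -- Both counts are the number of flows, so their equality is definitional.
  , n , n
  , Bijection.trans partition⤖flow (↔⇒⤖ flow↔Fin)
  , Bijection.trans (inverse juggling) (↔⇒⤖ flow↔Fin)
  , refl
  where
  -- Two units entering at the first vertex: at once the root 2ε_1 and the initial state ⟨2⟩. Here
  -- `r` is one less than the rank.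
  v = endpoints (loop {r})

  inverse : ∀ {A : Set} {S} → Bijection (setoid A) S → Bijection S (setoid A)
  inverse = Inverse.Inverse⇒Bijection ∘ Inverse.sym ∘ Bijection.Bijection⇒Inverse

  partition⤖flow = inverse (subst (λ μ → Bijection (setoid (Flow v)) (Partitions μ)) (sym ε₀+ε₀)
    (FlowPartition.flow⤖partition v (sum-endpoints (loop {r}))))

  juggling : Bijection (setoid (Flow v)) (JS ⟨ + 2 ∷ [] ⟩ ⟨ + 2 ∷ [] ⟩ (suc r))
  -- At the start nothing is under way to the sink; at the end both units are at it.
  juggling = flow⤖juggling v 0 2 _ _
    (λ { zero → refl ; (suc k) → cong +_ (profile-zeros r k) })
    (λ { zero → refl ; (suc k) → refl })
    (λ T ds f → trans (flow-sum v T ds f) (sum-endpoints (loop {r})))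

  n = proj₁ (finite-flow v)
  flow↔Fin = proj₂ (finite-flow v)
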